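{- Let $s_l=(a_j)$, $1\le j\le l$, be an ordered string of non-negative integers, let $k=\max\{a_j:1\le j\le l\}$, and let $r$ be a non-negative integer. Then the ornated graph $O_{(2k+1)+r}(s_l)$ has exactly $r+1$ vertices with the maximum possible degree $\Delta(O_{(2k+1)+r}(s_l))=2\sum_{j=1}^{l}a_j$.
   Context: An ordered string $s_l=(a_j)$, $1\le j\le l$ ($l\ge 1$), is an $l$-tuple of non-negative integers; $j$ is the index of the entry $a_j$. For a positive integer $n$, the ornated graph $O_n(s_l)$ is the (in general non-simple) directed graph on vertices $v_1,\dots,v_n$ whose arcs, counted with multiplicity, are the following: each odd-indexed entry $a_t$ contributes one arc $(v_i,v_j)$ for every pair $i<j$ with $i+a_t\ge j$; each even-indexed entry $a_s$ contributes one arc $(v_i,v_j)$ for every pair $i>j$ with $i-a_s\le j$. The degree of a vertex is $d(v)=d^+(v)+d^-(v)$ (out-degree plus in-degree, with multiplicity), and $\Delta(O_n(s_l))$ is the maximum degree. The maximum possible degree associated with $s_l$ is $\max_{n\ge 1}\Delta(O_n(s_l))$. -}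

module Defs where

open import Data.Nat using (ℕ; suc; _+_; _∸_; _⊔_; _≤_; _<_; _>_; _≥_; _≤?_; _<?_; _>?_; _≥?_; _≟_; parity)
open import Data.Fin using (Fin; toℕ)
open import Data.Parity using (Parity; 0ℙ; 1ℙ)
open import Data.Product using (_×_; ∃-syntax)
open import Data.Vec using (Vec; lookup; tabulate; allFin; sum; count; foldr′)
open import Relation.Binary.PropositionalEquality using (_≡_)
open import Relation.Nullary using (Dec)
open import Relation.Nullary.Decidable using (_×-dec_)

-- On a nonempty vector the unit 0 has no effect on the value.
maximum : ∀ {n} → Vec ℕ n → ℕ
maximum = foldr′ _⊔_ 0

-- A directed multigraph on n vertices, where multiplicity u v is the number
-- of arcs from u to v.
record MultiDigraph (n : ℕ) : Set where
  field
    multiplicity : Fin n → Fin n → ℕ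

open MultiDigraph public

module _ {n : ℕ} (G : MultiDigraph n) where

  outDegree inDegree degree : Fin n → ℕ
  outDegree v = sum (tabulate λ w → multiplicity G v w)
  inDegree  v = sum (tabulate λ w → multiplicity G w v)
  degree    v = outDegree v + inDegree v

  Δ : ℕ
  Δ = maximum (tabulate degree)

  verticesOfDegree : ℕ → ℕ
  verticesOfDegree d = count (λ v → degree v ≟ d) (allFin n)

-- Whether an entry a, whose index has the given parity, contributes an arc
-- from i to j. The vertex v_i is represented by the element i - 1 of Fin n;
-- the conditions depend only on the difference of the two indices, so the
-- shift is harmless. Truncated subtraction agrees with integer subtraction
-- here, since the right-hand side j is non-negative.
Contributes : ∀ {n} → Parity → ℕ → Fin n → Fin n → Set
Contributes 1ℙ a i j = toℕ i < toℕ j × toℕ i + a ≥ toℕ j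
Contributes 0ℙ a i j = toℕ i > toℕ j × toℕ i ∸ a ≤ toℕ j

contributes? : ∀ {n} (p : Parity) (a : ℕ) (i j : Fin n) → Dec (Contributes p a i j)
contributes? 1ℙ a i j = (toℕ i <? toℕ j) ×-dec (toℕ i + a ≥? toℕ j)
contributes? 0ℙ a i j = (toℕ i >? toℕ j) ×-dec (toℕ i ∸ a ≤? toℕ j)

-- The entry a_t of the string is lookup s at position t - 1, hence the suc.
indexParity : ∀ {l} → Fin l → Parity
indexParity t = parity (suc (toℕ t))

ornated : ∀ {l} (n : ℕ) → Vec ℕ l → MultiDigraph n
ornated {l} n s .multiplicity i j =
  count (λ t → contributes? (indexParity t) (lookup s t) i j) (allFin l)

-- D = max { Δ (O_n(s)) : n ≥ 1 }. As n ranges over an infinite set, the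
-- maximum is specified as an attained upper bound.
IsMaximumPossibleDegree : ∀ {l} → Vec ℕ l → ℕ → Set
IsMaximumPossibleDegree s D =
  (∃[ n ] 1 ≤ n × Δ (ornated n s) ≡ D) × (∀ n → 1 ≤ n → Δ (ornated n s) ≤ D)

{-# OPTIONS --safe #-}

-- An entry a of either parity joins v_i to the a vertices on each side of it, as far
-- as they exist, so it contributes min(a, i - 1) + min(a, n - i) to the degree of v_i.
-- Hence the degree is at most 2 Σ a_j, with equality iff every entry, that is, their
-- maximum k, is at most both i - 1 and n - i; for n = 2k + 1 + r this leaves r + 1
-- vertices.
module Submission where

open import Defs
import Algebra.Properties.CommutativeMonoid.Sum as Sum
open import Data.Bool using (true; false; if_then_else_)
open import Data.Fin using (Fin; zero; suc; toℕ; fromℕ<)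
open import Data.Fin.Properties using (toℕ<n; toℕ-fromℕ<)
open import Data.Nat using (ℕ; zero; suc; pred; _+_; _*_; _∸_; _⊓_; _≤_; _<_; _≟_; z≤n; s≤s; s≤s⁻¹)
open import Data.Nat.Properties
open import Data.Parity using (Parity; 0ℙ; 1ℙ)
open import Data.Product using (_×_; _,_; swap; map₂)
open import Data.Vec using (Vec; []; _∷_; sum; lookup; tabulate; count)
open import Data.Vec.Properties using (tabulate∘lookup; lookup∘tabulate)
open import Function using (_∘_; id; _⇔_; mk⇔; Equivalence)
open import Relation.Binary.PropositionalEquality using (_≡_; _≗_; refl; sym; trans; cong; cong₂; subst; module ≡-Reasoning)
open import Relation.Nullary using (Dec; does)
open import Relation.Nullary.Decidable using (does-⇔; _×-dec_)
open import Relation.Unary using (Pred; Decidable)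

open Sum +-0-commutativeMonoid
  using (sum-syntax; sum-cong-≗; ∑-distrib-+; ∑-comm) renaming (sum to ∑)

private
  variable
    l n : ℕ

-- Finite sums and maxima

sum-tabulate : (f : Fin n → ℕ) → sum (tabulate f) ≡ ∑ f
sum-tabulate {zero}  f = refl
sum-tabulate {suc n} f = cong (f zero +_) (sum-tabulate (f ∘ suc))

∑-lookup : (s : Vec ℕ l) → ∑ (lookup s) ≡ sum s
∑-lookup s = trans (sym (sum-tabulate (lookup s))) (cong sum (tabulate∘lookup s))

∑-mono-≤ : {f g : Fin n → ℕ} → (∀ i → f i ≤ g i) → ∑ f ≤ ∑ g
∑-mono-≤ {zero}  f≤g = z≤n
∑-mono-≤ {suc n} f≤g = +-mono-≤ (f≤g zero) (∑-mono-≤ (f≤g ∘ suc))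

+-≤-tightˡ : ∀ {m n o p} → m ≤ o → n ≤ p → m + n ≡ o + p → m ≡ o
+-≤-tightˡ {m} {n} {o} {p} m≤o n≤p eq = ≤-antisym m≤o
  (+-cancelʳ-≤ p o m (≤-trans (≤-reflexive (sym eq)) (+-monoʳ-≤ m n≤p)))

+-≤-tightʳ : ∀ {m n o p} → m ≤ o → n ≤ p → m + n ≡ o + p → n ≡ p
+-≤-tightʳ {m} {n} {o} {p} m≤o n≤p eq =
  +-≤-tightˡ n≤p m≤o (trans (+-comm n m) (trans eq (+-comm o p)))

∑-≤-tight : {f g : Fin n → ℕ} → (∀ i → f i ≤ g i) → ∑ f ≡ ∑ g → f ≗ g
∑-≤-tight f≤g eq zero    = +-≤-tightˡ (f≤g zero) (∑-mono-≤ (f≤g ∘ suc)) eq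
∑-≤-tight f≤g eq (suc i) =
  ∑-≤-tight (f≤g ∘ suc) (+-≤-tightʳ (f≤g zero) (∑-mono-≤ (f≤g ∘ suc)) eq) i

lookup≤maximum : (s : Vec ℕ l) → ∀ i → lookup s i ≤ maximum s
lookup≤maximum (x ∷ s) zero    = m≤m⊔n x (maximum s)
lookup≤maximum (x ∷ s) (suc i) = ≤-trans (lookup≤maximum s i) (m≤n⊔m x (maximum s))

maximum-lub : ∀ {b} (s : Vec ℕ l) → (∀ i → lookup s i ≤ b) → maximum s ≤ b
maximum-lub []      s≤b = z≤n
maximum-lub (x ∷ s) s≤b = ⊔-lub (s≤b zero) (maximum-lub s (s≤b ∘ suc))

degree≤Δ : (G : MultiDigraph n) (v : Fin n) → degree G v ≤ Δ G
degree≤Δ G v = ≤-trans (≤-reflexive (sym (lookup∘tabulate (degree G) v)))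
                       (lookup≤maximum (tabulate (degree G)) v)

-- Counting

indicator : ∀ {a} {A : Set a} → Dec A → ℕ
indicator a? = if does a? then 1 else 0

indicator-⇔ : ∀ {a b} {A : Set a} {B : Set b} (a? : Dec A) (b? : Dec B) →
  A ⇔ B → indicator a? ≡ indicator b?
indicator-⇔ a? b? A⇔B = cong (if_then 1 else 0) (does-⇔ A⇔B a? b?)

count-tabulate : ∀ {a p} {A : Set a} {P : Pred A p} (P? : Decidable P) (f : Fin n → A) →
  count P? (tabulate f) ≡ ∑ (indicator ∘ P? ∘ f)
count-tabulate {zero}  P? f = refl
count-tabulate {suc n} P? f with does (P? (f zero))
... | true  = cong suc (count-tabulate P? (f ∘ suc))
... | false = count-tabulate P? (f ∘ suc)

∑-indicator-interval : ∀ {p} {P : Pred (Fin n) p} (P? : Decidable P) lo hi →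
  (∀ i → P i ⇔ (lo ≤ toℕ i × toℕ i < hi)) →
  ∑ (indicator ∘ P?) ≡ (hi ⊓ n) ∸ lo
∑-indicator-interval {n} P? lo hi P⇔ = trans
  (sum-cong-≗ (λ i → indicator-⇔ (P? i) ((lo ≤? toℕ i) ×-dec (toℕ i <? hi)) (P⇔ i)))
  (count-interval n lo hi)
  where
  count-interval : ∀ n lo hi →
    (∑[ i < n ] indicator ((lo ≤? toℕ i) ×-dec (toℕ i <? hi))) ≡ (hi ⊓ n) ∸ lo
  shift : ∀ n lo hi →
    (∑[ i < n ] indicator ((lo ≤? suc (toℕ i)) ×-dec (suc (toℕ i) <? hi))) ≡
    (pred hi ⊓ n) ∸ pred lo
  shift n lo hi = trans
    (sum-cong-≗ {n} λ i → indicator-⇔ ((lo ≤? suc (toℕ i)) ×-dec (suc (toℕ i) <? hi))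
                                       ((pred lo ≤? toℕ i) ×-dec (toℕ i <? pred hi))
      (mk⇔ (λ (p , q) → pred-mono-≤ p , pred-mono-≤ q)
           (λ (p , q) → suc-pred≤ lo p , <pred hi q)))
    (count-interval n (pred lo) (pred hi))
    where
    suc-pred≤ : ∀ m {i} → pred m ≤ i → m ≤ suc i
    suc-pred≤ zero    _ = z≤n
    suc-pred≤ (suc m) p = s≤s p
    <pred : ∀ m {i} → i < pred m → suc i < m
    <pred (suc m) p = s≤s p
  count-interval zero    lo hi = sym (trans (cong (_∸ lo) (⊓-zeroʳ hi)) (0∸n≡0 lo))
  count-interval (suc n) zero     zero     = shift n zero zero
  count-interval (suc n) zero     (suc hi) = cong suc (shift n zero (suc hi))
  count-interval (suc n) (suc lo) zero     = trans (shift n (suc lo) zero) (0∸n≡0 lo)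
  count-interval (suc n) (suc lo) (suc hi) = shift n (suc lo) (suc hi)

-- The degree of a vertex of an ornated graph

m∸n≤o⇔m≤o+n : ∀ m n o → (m ∸ n ≤ o) ⇔ (m ≤ o + n)
m∸n≤o⇔m≤o+n m n o = mk⇔
  (λ m∸n≤o → subst (m ≤_) (+-comm n o) (≤-trans (m≤n+m∸n m n) (+-monoʳ-≤ n m∸n≤o)))
  (λ m≤o+n → m≤n+o⇒m∸n≤o m n (subst (m ≤_) (+-comm o n) m≤o+n))

module _ (a : ℕ) (v : Fin n) where

  rightReach leftReach : ℕ
  rightReach = a ⊓ (n ∸ suc (toℕ v))
  leftReach  = a ⊓ toℕ v

  rightInterval : (suc (toℕ v + a) ⊓ n) ∸ suc (toℕ v) ≡ rightReach
  rightInterval = trans (∸-distribʳ-⊓ (suc (toℕ v)) (suc (toℕ v + a)) n)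
                        (cong (_⊓ _) (m+n∸m≡n (toℕ v) a))

  leftInterval : (toℕ v ⊓ n) ∸ (toℕ v ∸ a) ≡ leftReach
  leftInterval = begin
    (toℕ v ⊓ n) ∸ (toℕ v ∸ a)             ≡⟨ cong (_∸ (toℕ v ∸ a)) (m≤n⇒m⊓n≡m (<⇒≤ (toℕ<n v))) ⟩
    toℕ v ∸ (toℕ v ∸ a)                   ≡⟨ cong (_∸ (toℕ v ∸ a)) (m⊓n+n∸m≡n a (toℕ v)) ⟨
    (leftReach + (toℕ v ∸ a)) ∸ (toℕ v ∸ a) ≡⟨ m+n∸n≡m leftReach (toℕ v ∸ a) ⟩
    leftReach                             ∎
    where open ≡-Reasoning

  ∑-contributes : ∀ p →
    (∑[ w < n ] indicator (contributes? p a v w)) + (∑[ w < n ] indicator (contributes? p a w v))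
    ≡ leftReach + rightReach
  ∑-contributes 1ℙ = trans (cong₂ _+_
    (trans (∑-indicator-interval (contributes? 1ℙ a v) _ _ λ w →
              mk⇔ (map₂ s≤s) (map₂ s≤s⁻¹))
           rightInterval)
    (trans (∑-indicator-interval (λ w → contributes? 1ℙ a w v) _ _ λ w →
              mk⇔ (swap ∘ map₂ (Equivalence.from (m∸n≤o⇔m≤o+n (toℕ v) a (toℕ w))))
                  (map₂ (Equivalence.to (m∸n≤o⇔m≤o+n (toℕ v) a (toℕ w))) ∘ swap))
           leftInterval))
    (+-comm rightReach leftReach)
  ∑-contributes 0ℙ = cong₂ _+_
    (trans (∑-indicator-interval (contributes? 0ℙ a v) _ _ λ w →
              mk⇔ swap swap)
           leftInterval)
    (trans (∑-indicator-interval (λ w → contributes? 0ℙ a w v) _ _ λ w →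
              mk⇔ (map₂ (s≤s ∘ Equivalence.to (m∸n≤o⇔m≤o+n (toℕ w) a (toℕ v))))
                  (map₂ (Equivalence.from (m∸n≤o⇔m≤o+n (toℕ w) a (toℕ v)) ∘ s≤s⁻¹)))
           rightInterval)

module _ (s : Vec ℕ l) where

  private
    k = maximum s

    arc : (v w : Fin n) → Fin l → ℕ
    arc v w t = indicator (contributes? (indexParity t) (lookup s t) v w)

  sum-multiplicity : (i j : Fin n → Fin n) →
    sum (tabulate λ w → multiplicity (ornated n s) (i w) (j w)) ≡
    ∑[ t < l ] ∑[ w < n ] arc (i w) (j w) t
  sum-multiplicity {n} i j = begin
    sum (tabulate λ w → multiplicity (ornated n s) (i w) (j w))
      ≡⟨ sum-tabulate (λ w → multiplicity (ornated n s) (i w) (j w)) ⟩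
    (∑[ w < n ] multiplicity (ornated n s) (i w) (j w))
      ≡⟨ sum-cong-≗ (λ w → count-tabulate (λ t → contributes? (indexParity t) (lookup s t) (i w) (j w)) id) ⟩
    (∑[ w < n ] ∑[ t < l ] arc (i w) (j w) t)
      ≡⟨ ∑-comm (λ w → arc (i w) (j w)) ⟩
    (∑[ t < l ] ∑[ w < n ] arc (i w) (j w) t) ∎
    where open ≡-Reasoning

  degree-ornated : (v : Fin n) → degree (ornated n s) v ≡
    (∑[ t < l ] leftReach (lookup s t) v) + (∑[ t < l ] rightReach (lookup s t) v)
  degree-ornated {n} v = begin
    degree (ornated n s) v
      ≡⟨ cong₂ _+_ (sum-multiplicity (λ _ → v) id) (sum-multiplicity id (λ _ → v)) ⟩
    (∑[ t < l ] ∑[ w < n ] arc v w t) + (∑[ t < l ] ∑[ w < n ] arc w v t)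
      ≡⟨ ∑-distrib-+ (λ t → ∑[ w < n ] arc v w t) (λ t → ∑[ w < n ] arc w v t) ⟨
    (∑[ t < l ] ((∑[ w < n ] arc v w t) + (∑[ w < n ] arc w v t)))
      ≡⟨ sum-cong-≗ (λ t → ∑-contributes (lookup s t) v (indexParity t)) ⟩
    (∑[ t < l ] (leftReach (lookup s t) v + rightReach (lookup s t) v))
      ≡⟨ ∑-distrib-+ (λ t → leftReach (lookup s t) v) (λ t → rightReach (lookup s t) v) ⟩
    (∑[ t < l ] leftReach (lookup s t) v) + (∑[ t < l ] rightReach (lookup s t) v) ∎
    where open ≡-Reasoning

  ∑-⊓≤sum : ∀ b → (∑[ t < l ] (lookup s t ⊓ b)) ≤ sum s
  ∑-⊓≤sum b = ≤-trans (∑-mono-≤ (λ t → m⊓n≤m (lookup s t) b)) (≤-reflexive (∑-lookup s))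

  ∑-⊓≡sum⇔maximum≤ : ∀ b → (∑[ t < l ] (lookup s t ⊓ b)) ≡ sum s ⇔ k ≤ b
  ∑-⊓≡sum⇔maximum≤ b = mk⇔
    (λ eq → maximum-lub s λ t → m⊓n≡m⇒m≤n
      (∑-≤-tight (λ t → m⊓n≤m (lookup s t) b) (trans eq (sym (∑-lookup s))) t))
    (λ k≤b → trans
      (sum-cong-≗ (λ t → m≤n⇒m⊓n≡m (≤-trans (lookup≤maximum s t) k≤b)))
      (∑-lookup s))

  2*sum : 2 * sum s ≡ sum s + sum s
  2*sum = cong (sum s +_) (+-identityʳ (sum s))

  degree≤2*sum : (v : Fin n) → degree (ornated n s) v ≤ 2 * sum s
  degree≤2*sum {n} v = begin
    degree (ornated n s) v ≡⟨ degree-ornated v ⟩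
    (∑[ t < l ] leftReach (lookup s t) v) + (∑[ t < l ] rightReach (lookup s t) v)
                           ≤⟨ +-mono-≤ (∑-⊓≤sum (toℕ v)) (∑-⊓≤sum (n ∸ suc (toℕ v))) ⟩
    sum s + sum s          ≡⟨ 2*sum ⟨
    2 * sum s              ∎
    where open ≤-Reasoning

  degree≡2*sum⇔ : k ≤ n → (v : Fin n) →
    degree (ornated n s) v ≡ 2 * sum s ⇔ (k ≤ toℕ v × toℕ v < n ∸ k)
  degree≡2*sum⇔ {n} k≤n v = mk⇔
    (λ eq → let eq′ = trans (sym (degree-ornated v)) (trans eq 2*sum) in
      Equivalence.to left⇔ (+-≤-tightˡ left≤ right≤ eq′) ,
      ≤∸-swap (toℕ<n v) (Equivalence.to right⇔ (+-≤-tightʳ left≤ right≤ eq′)))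
    (λ (k≤v , v<n∸k) → trans (degree-ornated v) (trans
      (cong₂ _+_ (Equivalence.from left⇔ k≤v) (Equivalence.from right⇔ (≤∸-swap k≤n v<n∸k)))
      (sym 2*sum)))
    where
    left⇔  = ∑-⊓≡sum⇔maximum≤ (toℕ v)
    right⇔ = ∑-⊓≡sum⇔maximum≤ (n ∸ suc (toℕ v))
    left≤  = ∑-⊓≤sum (toℕ v)
    right≤ = ∑-⊓≤sum (n ∸ suc (toℕ v))
    ≤∸-swap : ∀ {a b} → b ≤ n → a ≤ n ∸ b → b ≤ n ∸ a
    ≤∸-swap {a} {b} b≤n a≤n∸b =
      m+n≤o⇒m≤o∸n b (subst (_≤ n) (+-comm a b) (m≤o∸n⇒m+n≤o a b≤n a≤n∸b))

  Δ≤2*sum : ∀ n → Δ (ornated n s) ≤ 2 * sum s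
  Δ≤2*sum n = maximum-lub (tabulate (degree (ornated n s))) λ v →
    ≤-trans (≤-reflexive (lookup∘tabulate (degree (ornated n s)) v)) (degree≤2*sum v)

  Δ≡2*sum : k < n ∸ k → Δ (ornated n s) ≡ 2 * sum s
  Δ≡2*sum {n} k<n∸k = ≤-antisym (Δ≤2*sum n) (≤-trans
    (≤-reflexive (sym (Equivalence.from (degree≡2*sum⇔ (<⇒≤ k<n) v)
      (≤-reflexive (sym v≡k) , subst (_< n ∸ k) (sym v≡k) k<n∸k))))
    (degree≤Δ (ornated n s) v))
    where
    k<n : k < n
    k<n = <-≤-trans k<n∸k (m∸n≤m n k)
    v   = fromℕ< k<n
    v≡k = toℕ-fromℕ< k<n

  verticesOfDegree-2*sum : k ≤ n → verticesOfDegree (ornated n s) (2 * sum s) ≡ n ∸ k ∸ k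
  verticesOfDegree-2*sum {n} k≤n = begin
    verticesOfDegree (ornated n s) (2 * sum s) ≡⟨ count-tabulate full? id ⟩
    ∑ (indicator ∘ full?)                      ≡⟨ ∑-indicator-interval full? k (n ∸ k) (degree≡2*sum⇔ k≤n) ⟩
    ((n ∸ k) ⊓ n) ∸ k                          ≡⟨ cong (_∸ k) (m≤n⇒m⊓n≡m (m∸n≤m n k)) ⟩
    n ∸ k ∸ k                                  ∎
    where
    open ≡-Reasoning
    full? = λ v → degree (ornated n s) v ≟ 2 * sum s

2*k+1+r∸k : ∀ k r → (2 * k + 1) + r ∸ k ≡ k + (r + 1)
2*k+1+r∸k k r = begin
  (2 * k + 1) + r ∸ k         ≡⟨ cong (_∸ k) (+-assoc (2 * k) 1 r) ⟩
  2 * k + (1 + r) ∸ k         ≡⟨ cong (_∸ k) (+-assoc k (k + 0) (1 + r)) ⟩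
  k + ((k + 0) + (1 + r)) ∸ k ≡⟨ m+n∸m≡n k _ ⟩
  (k + 0) + (1 + r)           ≡⟨ cong₂ _+_ (+-identityʳ k) (+-comm 1 r) ⟩
  k + (r + 1)                 ∎
  where open ≡-Reasoning

proposition2p10 : (l : ℕ) → 1 ≤ l → (s : Vec ℕ l) (r : ℕ) →
    let k = maximum s
        O = ornated ((2 * k + 1) + r) s
    in IsMaximumPossibleDegree s (Δ O)
       × Δ O ≡ 2 * sum s
       × verticesOfDegree O (Δ O) ≡ r + 1
proposition2p10 l _ s r =
  ((N , 1≤N , refl) , λ m _ → ≤-trans (Δ≤2*sum s m) (≤-reflexive (sym ΔO))) ,
  ΔO ,
  (begin
    verticesOfDegree O (Δ O)       ≡⟨ cong (verticesOfDegree O) ΔO ⟩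
    verticesOfDegree O (2 * sum s) ≡⟨ verticesOfDegree-2*sum s (<⇒≤ k<N) ⟩
    N ∸ k ∸ k                      ≡⟨ cong (_∸ k) (2*k+1+r∸k k r) ⟩
    k + (r + 1) ∸ k                ≡⟨ m+n∸m≡n k (r + 1) ⟩
    r + 1                          ∎)
  where
  open ≡-Reasoning
  k = maximum s
  N = (2 * k + 1) + r
  O = ornated N s
  k<N∸k : k < N ∸ k
  k<N∸k = subst (k <_) (sym (2*k+1+r∸k k r)) (m<m+n k (m≤n+m 1 r))
  k<N : k < N
  k<N = <-≤-trans k<N∸k (m∸n≤m N k)
  1≤N : 1 ≤ N
  1≤N = ≤-trans (s≤s z≤n) k<N
  ΔO : Δ O ≡ 2 * sum s
  ΔO = Δ≡2*sum s k<N∸k
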